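{- Let $Q = Q_b = (b,a,-b)$, i.e. $Q(X,Y) = bX^2 + aXY - bY^2$ with $a,b \in \mathbb{Z}$, be a quadratic form with discriminant $m = a^2 + 4b^2$. If the equation $$Q(r,s) = b r^2 + a r s - b s^2 = 2x^2$$ has a solution $(r,s,x)$ in nonzero integers, then $$\alpha = 2x(1+i), \qquad \beta = r + si, \qquad \gamma = s + ri$$ satisfy the equation $$\alpha^2 - (a+2bi)\beta^2 - (a-2bi)\gamma^2 = 0.$$ Moreover, $\gcd(r,s) \mid \gcd(\alpha,\beta)$.
   Context: Here $i = \sqrt{ -1}$; $\gcd(\alpha,\beta)$ and the divisibility $\gcd(r,s) \mid \gcd(\alpha,\beta)$ are taken in $\mathbb{Z}[i]$. -}

module Defs where

open import Algebra.Bundles using (CommutativeRing; Semiring)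
import Algebra.Definitions.RawMagma as Magma
import Algebra.Definitions.RawSemiring as RawSemiringDefinitions
import Algebra.Properties.Semiring.Divisibility as Divisibility
open import Algebra.Structures using (IsCommutativeRing)
open import Data.Integer using (ℤ; +_; -[1+_]; 0ℤ; 1ℤ; -_; _+_; _-_; _*_; _^_; ∣_∣)
import Data.Integer.DivMod as ℤ
import Data.Integer.Properties as ℤ
open import Data.Integer.Tactic.RingSolver using (solve-∀)
open import Data.Nat as ℕ using (ℕ; NonZero)
open import Data.Nat.Induction using (<-wellFounded)
import Data.Nat.Properties as ℕ
open import Data.Nat.Tactic.RingSolver using () renaming (solve-∀ to solve-∀ℕ)
open import Data.Product using (∃; ∃-syntax; _×_; _,_)
open import Induction.WellFounded using (Acc; acc)
open import Level using (0ℓ)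
open import Relation.Binary.PropositionalEquality
open import Relation.Nullary using (Dec; yes; no)

record BinaryQuadraticForm : Set where
  constructor ⟨_,_,_⟩
  field
    A B C : ℤ

  eval : ℤ → ℤ → ℤ
  eval X Y = A * X ^ 2 + B * X * Y + C * Y ^ 2

  discriminant : ℤ
  discriminant = B ^ 2 - + 4 * A * C

open BinaryQuadraticForm public using (eval; discriminant)

infix 5 _+i_

record ℤ[i] : Set where
  constructor _+i_
  field
    re im : ℤ

open ℤ[i] public

fromℤ : ℤ → ℤ[i]
fromℤ n = n +i 0ℤ

infixl 6 _+ᵍ_ _-ᵍ_
infixl 7 _*ᵍ_
infix  8 -ᵍ_

_+ᵍ_ _*ᵍ_ : ℤ[i] → ℤ[i] → ℤ[i]
(a +i b) +ᵍ (c +i d) = (a + c) +i (b + d)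
(a +i b) *ᵍ (c +i d) = (a * c - b * d) +i (a * d + b * c)

-ᵍ_ : ℤ[i] → ℤ[i]
-ᵍ (a +i b) = (- a) +i (- b)

_-ᵍ_ : ℤ[i] → ℤ[i] → ℤ[i]
α -ᵍ β = α +ᵍ -ᵍ β

0ᵍ 1ᵍ : ℤ[i]
0ᵍ = fromℤ 0ℤ
1ᵍ = fromℤ 1ℤ

ℤ[i]-isCommutativeRing : IsCommutativeRing _≡_ _+ᵍ_ _*ᵍ_ -ᵍ_ 0ᵍ 1ᵍ
ℤ[i]-isCommutativeRing = record
  { isRing = record
    { +-isAbelianGroup = record
      { isGroup = record
        { isMonoid = record
          { isSemigroup = record
            { isMagma = record
              { isEquivalence = isEquivalence
              ; ∙-cong = cong₂ _+ᵍ_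
              }
            ; assoc = λ (a +i b) (c +i d) (e +i f) →
                cong₂ _+i_ (ℤ.+-assoc a c e) (ℤ.+-assoc b d f)
            }
          ; identity =
                (λ (a +i b) → cong₂ _+i_ (ℤ.+-identityˡ a) (ℤ.+-identityˡ b))
              , (λ (a +i b) → cong₂ _+i_ (ℤ.+-identityʳ a) (ℤ.+-identityʳ b))
          }
        ; inverse =
              (λ (a +i b) → cong₂ _+i_ (ℤ.+-inverseˡ a) (ℤ.+-inverseˡ b))
            , (λ (a +i b) → cong₂ _+i_ (ℤ.+-inverseʳ a) (ℤ.+-inverseʳ b))
        ; ⁻¹-cong = cong (λ α → -ᵍ α)
        }
      ; comm = λ (a +i b) (c +i d) → cong₂ _+i_ (ℤ.+-comm a c) (ℤ.+-comm b d)
      }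
    ; *-cong = cong₂ _*ᵍ_
    ; *-assoc = λ (a +i b) (c +i d) (e +i f) →
        cong₂ _+i_ (assoc-re a b c d e f) (assoc-im a b c d e f)
    ; *-identity =
          (λ (a +i b) → cong₂ _+i_ (idˡ-re a b) (idˡ-im a b))
        , (λ (a +i b) → cong₂ _+i_ (idʳ-re a b) (idʳ-im a b))
    ; distrib =
          (λ (a +i b) (c +i d) (e +i f) →
            cong₂ _+i_ (distˡ-re a b c d e f) (distˡ-im a b c d e f))
        , (λ (a +i b) (c +i d) (e +i f) →
            cong₂ _+i_ (distʳ-re a b c d e f) (distʳ-im a b c d e f))
    }
  ; *-comm = λ (a +i b) (c +i d) →
      cong₂ _+i_ (comm-re a b c d) (comm-im a b c d)
  }
  where
  assoc-re : ∀ a b c d e f → (a * c - b * d) * e - (a * d + b * c) * f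
                           ≡ a * (c * e - d * f) - b * (c * f + d * e)
  assoc-re = solve-∀
  assoc-im : ∀ a b c d e f → (a * c - b * d) * f + (a * d + b * c) * e
                           ≡ a * (c * f + d * e) + b * (c * e - d * f)
  assoc-im = solve-∀
  idˡ-re : ∀ a b → 1ℤ * a - 0ℤ * b ≡ a
  idˡ-re = solve-∀
  idˡ-im : ∀ a b → 1ℤ * b + 0ℤ * a ≡ b
  idˡ-im = solve-∀
  idʳ-re : ∀ a b → a * 1ℤ - b * 0ℤ ≡ a
  idʳ-re = solve-∀
  idʳ-im : ∀ a b → a * 0ℤ + b * 1ℤ ≡ b
  idʳ-im = solve-∀
  distˡ-re : ∀ a b c d e f → a * (c + e) - b * (d + f)
                           ≡ (a * c - b * d) + (a * e - b * f)
  distˡ-re = solve-∀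
  distˡ-im : ∀ a b c d e f → a * (d + f) + b * (c + e)
                           ≡ (a * d + b * c) + (a * f + b * e)
  distˡ-im = solve-∀
  distʳ-re : ∀ a b c d e f → (c + e) * a - (d + f) * b
                           ≡ (c * a - d * b) + (e * a - f * b)
  distʳ-re = solve-∀
  distʳ-im : ∀ a b c d e f → (c + e) * b + (d + f) * a
                           ≡ (c * b + d * a) + (e * b + f * a)
  distʳ-im = solve-∀
  comm-re : ∀ a b c d → a * c - b * d ≡ c * a - d * b
  comm-re = solve-∀
  comm-im : ∀ a b c d → a * d + b * c ≡ c * b + d * a
  comm-im = solve-∀

ℤ[i]-commutativeRing : CommutativeRing 0ℓ 0ℓ
ℤ[i]-commutativeRing = record { isCommutativeRing = ℤ[i]-isCommutativeRing }

open RawSemiringDefinitions (Semiring.rawSemiring (CommutativeRing.semiring ℤ[i]-commutativeRing)) public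
  using () renaming (_∣_ to _∣ᵍ_; _^_ to _^ᵍ_)

-- Greatest common divisors in ℤ[i] are determined only up to a unit, so being
-- one is a relation rather than a function; gcdᵍ-exists below shows that every
-- pair has one.
record IsGCDᵍ (α β δ : ℤ[i]) : Set where
  field
    divides₁ : δ ∣ᵍ α
    divides₂ : δ ∣ᵍ β
    greatest : ∀ {η} → η ∣ᵍ α → η ∣ᵍ β → η ∣ᵍ δ

norm : ℤ[i] → ℕ
norm (a +i b) = ∣ a ∣ ℕ.* ∣ a ∣ ℕ.+ ∣ b ∣ ℕ.* ∣ b ∣

conj : ℤ[i] → ℤ[i]
conj (a +i b) = a +i - b

private
  ∣i∣*∣i∣≡i*i : ∀ i → + (∣ i ∣ ℕ.* ∣ i ∣) ≡ i * i
  ∣i∣*∣i∣≡i*i (+ n)    = ℤ.pos-* n n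
  ∣i∣*∣i∣≡i*i -[1+ n ] = refl

  +norm : ∀ a b → + norm (a +i b) ≡ a * a + b * b
  +norm a b = cong₂ _+_ (∣i∣*∣i∣≡i*i a) (∣i∣*∣i∣≡i*i b)

  norm-*ᵍ : ∀ α β → norm (α *ᵍ β) ≡ norm α ℕ.* norm β
  norm-*ᵍ (a +i b) (c +i d) = ℤ.+-injective (begin
    + norm ((a +i b) *ᵍ (c +i d))
      ≡⟨ +norm (a * c - b * d) (a * d + b * c) ⟩
    (a * c - b * d) * (a * c - b * d) + (a * d + b * c) * (a * d + b * c)
      ≡⟨ brahmagupta a b c d ⟩
    (a * a + b * b) * (c * c + d * d)
      ≡⟨ cong₂ _*_ (+norm a b) (+norm c d) ⟨
    + norm (a +i b) * + norm (c +i d)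
      ≡⟨ ℤ.pos-* (norm (a +i b)) (norm (c +i d)) ⟨
    + (norm (a +i b) ℕ.* norm (c +i d)) ∎)
    where
    open ≡-Reasoning
    brahmagupta : ∀ a b c d →
      (a * c - b * d) * (a * c - b * d) + (a * d + b * c) * (a * d + b * c)
      ≡ (a * a + b * b) * (c * c + d * d)
    brahmagupta = solve-∀

  norm-conj : ∀ α → norm (conj α) ≡ norm α
  norm-conj (a +i b) =
    cong (λ n → ∣ a ∣ ℕ.* ∣ a ∣ ℕ.+ n ℕ.* n) (ℤ.∣-i∣≡∣i∣ b)

  norm-*-conj : ∀ α β {γ} → α *ᵍ conj β ≡ γ → norm α ℕ.* norm β ≡ norm γ
  norm-*-conj α β eq = trans (cong (norm α ℕ.*_) (sym (norm-conj β)))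
    (trans (sym (norm-*ᵍ α (conj β))) (cong norm eq))

  norm≡0⇒≡0ᵍ : ∀ α → norm α ≡ 0 → α ≡ 0ᵍ
  norm≡0⇒≡0ᵍ (a +i b) eq =
    cong₂ _+i_ (root a (ℕ.m+n≡0⇒m≡0 _ eq)) (root b (ℕ.m+n≡0⇒n≡0 (∣ a ∣ ℕ.* ∣ a ∣) eq))
    where
    root : ∀ i → ∣ i ∣ ℕ.* ∣ i ∣ ≡ 0 → i ≡ 0ℤ
    root (+ 0) _ = refl

  -- division with remainder of least absolute value
  divMod : ∀ u n .{{_ : NonZero n}} →
           ∃[ q ] ∃[ ρ ] u ≡ ρ + q * + n × 2 ℕ.* ∣ ρ ∣ ℕ.≤ n
  divMod u n with 2 ℕ.* (u ℤ.%ℕ n) ℕ.≤? n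
  ... | yes 2r≤n = u ℤ./ℕ n , + (u ℤ.%ℕ n) , ℤ.a≡a%ℕn+[a/ℕn]*n u n , 2r≤n
  ... | no  2r≰n = q + 1ℤ , + r - + n , u≡ , small
    where
    q = u ℤ./ℕ n
    r = u ℤ.%ℕ n
    shift : ∀ r q n → r + q * n ≡ (r - n) + (q + 1ℤ) * n
    shift = solve-∀
    u≡ : u ≡ (+ r - + n) + (q + 1ℤ) * + n
    u≡ = trans (ℤ.a≡a%ℕn+[a/ℕn]*n u n) (shift (+ r) q (+ n))
    abs : ∣ + r - + n ∣ ≡ n ℕ.∸ r
    abs = trans (cong ∣_∣ (ℤ.m-n≡m⊖n r n)) (ℤ.∣⊖∣-≤ (ℕ.<⇒≤ (ℤ.n%ℕd<d u n)))
    small : 2 ℕ.* ∣ + r - + n ∣ ℕ.≤ n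
    small = begin
      2 ℕ.* ∣ + r - + n ∣     ≡⟨ cong (2 ℕ.*_) abs ⟩
      2 ℕ.* (n ℕ.∸ r)         ≡⟨ ℕ.*-distribˡ-∸ 2 n r ⟩
      2 ℕ.* n ℕ.∸ 2 ℕ.* r     ≤⟨ ℕ.∸-monoʳ-≤ (2 ℕ.* n) (ℕ.≰⇒≥ 2r≰n) ⟩
      2 ℕ.* n ℕ.∸ n           ≡⟨ cong (λ k → n ℕ.+ k ℕ.∸ n) (ℕ.+-identityʳ n) ⟩
      n ℕ.+ n ℕ.∸ n           ≡⟨ ℕ.m+n∸n≡m n n ⟩
      n                       ∎
      where open ℕ.≤-Reasoning

  smaller : ∀ k n x y .{{_ : NonZero n}} → k ℕ.* n ≡ x ℕ.* x ℕ.+ y ℕ.* y →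
            2 ℕ.* x ℕ.≤ n → 2 ℕ.* y ℕ.≤ n → k ℕ.< n
  smaller k n x y kn≡ 2x≤n 2y≤n = ℕ.*-cancelʳ-< n k n
    (ℕ.*-cancelˡ-< 4 (k ℕ.* n) (n ℕ.* n) (begin-strict
      4 ℕ.* (k ℕ.* n)                 ≡⟨ cong (4 ℕ.*_) kn≡ ⟩
      4 ℕ.* (x ℕ.* x ℕ.+ y ℕ.* y)     ≡⟨ quadruple x y ⟩
      (2 ℕ.* x) ℕ.* (2 ℕ.* x) ℕ.+ (2 ℕ.* y) ℕ.* (2 ℕ.* y)
        ≤⟨ ℕ.+-mono-≤ (ℕ.*-mono-≤ 2x≤n 2x≤n) (ℕ.*-mono-≤ 2y≤n 2y≤n) ⟩
      n ℕ.* n ℕ.+ n ℕ.* n             ≡⟨ double (n ℕ.* n) ⟩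
      2 ℕ.* (n ℕ.* n)                 <⟨ ℕ.*-monoˡ-< (n ℕ.* n) {2} {4} (ℕ.m≤m+n 3 1) ⟩
      4 ℕ.* (n ℕ.* n)                 ∎))
    where
    open ℕ.≤-Reasoning
    instance
      n*n≢0 : NonZero (n ℕ.* n)
      n*n≢0 = ℕ.m*n≢0 n n
    quadruple : ∀ x y → 4 ℕ.* (x ℕ.* x ℕ.+ y ℕ.* y)
                      ≡ (2 ℕ.* x) ℕ.* (2 ℕ.* x) ℕ.+ (2 ℕ.* y) ℕ.* (2 ℕ.* y)
    quadruple = solve-∀ℕ
    double : ∀ x → x ℕ.+ x ≡ 2 ℕ.* x
    double = solve-∀ℕ

  divModᵍ : ∀ α β → NonZero (norm β) →
            ∃[ κ ] ∃[ ρ ] α ≡ κ *ᵍ β +ᵍ ρ × norm ρ ℕ.< norm β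
  divModᵍ (a +i b) (c +i d) n≢0 = divide (divMod u n) (divMod v n)
    where
    instance
      n≢0′ : NonZero (norm (c +i d))
      n≢0′ = n≢0
    n = norm (c +i d)
    u = a * c - b * - d
    v = a * - d + b * c
    cancel : ∀ x y → y ≡ x + (y + - x)
    cancel = solve-∀
    re-id : ∀ a b c d q₁ q₂ →
      (a + - (q₁ * c - q₂ * d)) * c - (b + - (q₁ * d + q₂ * c)) * - d
      ≡ (a * c - b * - d) - q₁ * (c * c + d * d)
    re-id = solve-∀
    im-id : ∀ a b c d q₁ q₂ →
      (a + - (q₁ * c - q₂ * d)) * - d + (b + - (q₁ * d + q₂ * c)) * c
      ≡ (a * - d + b * c) - q₂ * (c * c + d * d)
    im-id = solve-∀
    drop : ∀ x y → (x + y) - y ≡ x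
    drop = solve-∀
    remainder : ∀ {w} ρ q → w ≡ ρ + q * + n → w - q * (c * c + d * d) ≡ ρ
    remainder ρ q eq = trans
      (cong₂ (λ w m → w - q * m) eq (sym (+norm c d))) (drop ρ (q * + n))
    divide : ∃[ q ] ∃[ ρ ] u ≡ ρ + q * + n × 2 ℕ.* ∣ ρ ∣ ℕ.≤ n →
             ∃[ q ] ∃[ ρ ] v ≡ ρ + q * + n × 2 ℕ.* ∣ ρ ∣ ℕ.≤ n →
             ∃[ κ ] ∃[ ρ ] (a +i b) ≡ κ *ᵍ (c +i d) +ᵍ ρ × norm ρ ℕ.< n
    divide (q₁ , ρ₁ , eq₁ , le₁) (q₂ , ρ₂ , eq₂ , le₂) =
        (q₁ +i q₂) , ρ
      , cong₂ _+i_ (cancel (q₁ * c - q₂ * d) a) (cancel (q₁ * d + q₂ * c) b)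
      , smaller (norm ρ) n ∣ ρ₁ ∣ ∣ ρ₂ ∣
          (norm-*-conj ρ (c +i d) product) le₁ le₂
      where
      ρ = (a +i b) -ᵍ (q₁ +i q₂) *ᵍ (c +i d)
      product : ρ *ᵍ conj (c +i d) ≡ ρ₁ +i ρ₂
      product = cong₂ _+i_
        (trans (re-id a b c d q₁ q₂) (remainder ρ₁ q₁ eq₁))
        (trans (im-id a b c d q₁ q₂) (remainder ρ₂ q₂ eq₂))

  open CommutativeRing ℤ[i]-commutativeRing using (semiring; distribʳ)
  open Divisibility semiring using (∣-refl; x∣ʳy⇒x∣ʳzy; _∣0)

  ∣ᵍ-+ᵍ : ∀ {η α β} → η ∣ᵍ α → η ∣ᵍ β → η ∣ᵍ α +ᵍ β
  ∣ᵍ-+ᵍ {η} (p Magma., eq₁) (q Magma., eq₂) =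
    (p +ᵍ q) Magma., trans (distribʳ η p q) (cong₂ _+ᵍ_ eq₁ eq₂)

  isGCDᵍ-zero : ∀ α → IsGCDᵍ α 0ᵍ α
  isGCDᵍ-zero α = record
    { divides₁ = ∣-refl ; divides₂ = α ∣0 ; greatest = λ η∣α _ → η∣α }

  subtract : ∀ κ β ρ → -ᵍ κ *ᵍ β +ᵍ (κ *ᵍ β +ᵍ ρ) ≡ ρ
  subtract (k +i l) (c +i d) (r +i s) =
    cong₂ _+i_ (re-id k l c d r) (im-id k l c d s)
    where
    re-id : ∀ k l c d r → (- k * c - - l * d) + (k * c - l * d + r) ≡ r
    re-id = solve-∀
    im-id : ∀ k l c d s → (- k * d + - l * c) + (k * d + l * c + s) ≡ s
    im-id = solve-∀

  isGCDᵍ-step : ∀ κ β ρ {δ} → IsGCDᵍ β ρ δ → IsGCDᵍ (κ *ᵍ β +ᵍ ρ) β δ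
  isGCDᵍ-step κ β ρ isGCD = record
    { divides₁ = ∣ᵍ-+ᵍ (x∣ʳy⇒x∣ʳzy κ δ∣β) δ∣ρ
    ; divides₂ = δ∣β
    ; greatest = λ {η} η∣α η∣β → greatest η∣β
        (subst (η ∣ᵍ_) (subtract κ β ρ) (∣ᵍ-+ᵍ (x∣ʳy⇒x∣ʳzy (-ᵍ κ) η∣β) η∣α))
    }
    where open IsGCDᵍ isGCD renaming (divides₁ to δ∣β; divides₂ to δ∣ρ)

  euclid : ∀ α β → Acc ℕ._<_ (norm β) → ∃ (IsGCDᵍ α β)
  euclid α β (acc rec) = go (norm β ℕ.≟ 0)
    where
    step : ∃[ κ ] ∃[ ρ ] α ≡ κ *ᵍ β +ᵍ ρ × norm ρ ℕ.< norm β → ∃ (IsGCDᵍ α β)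
    step (κ , ρ , α≡κβ+ρ , ρ<β) =
      let δ , isGCD = euclid β ρ (rec ρ<β) in
      δ , subst (λ α → IsGCDᵍ α β δ) (sym α≡κβ+ρ) (isGCDᵍ-step κ β ρ isGCD)
    go : Dec (norm β ≡ 0) → ∃ (IsGCDᵍ α β)
    go (yes n≡0) =
      α , subst (λ β → IsGCDᵍ α β α) (sym (norm≡0⇒≡0ᵍ β n≡0)) (isGCDᵍ-zero α)
    go (no  n≢0) = step (divModᵍ α β (ℕ.≢-nonZero n≢0))

gcdᵍ-exists : ∀ α β → ∃ (IsGCDᵍ α β)
gcdᵍ-exists α β = euclid α β (<-wellFounded (norm β))

{-# OPTIONS --safe #-}
module Submission where

open import Defs
open import Algebra.Bundles using (CommutativeRing)
open import Algebra.Definitions.RawMagma using (_,_)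
open import Data.Integer using (ℤ; +_; 0ℤ; 1ℤ; -_; _+_; _-_; _*_; _^_; ∣_∣)
open import Data.Integer.Divisibility.Signed using (_∣_; divides; ∣ᵤ⇒∣; ∣⇒∣ᵤ)
open import Data.Integer.GCD using (gcd; gcd[i,j]∣i; gcd[i,j]∣j)
import Data.Integer.Properties as ℤ
open import Data.Integer.Tactic.RingSolver using (solve-∀)
open import Data.Nat as ℕ using (zero; suc)
open import Data.Nat.Coprimality using (GCD≡1⇒coprime; coprime-divisor)
import Data.Nat.Divisibility as ℕ
open import Data.Nat.GCD using (GCD; GCD-*; gcd-GCD)
import Data.Nat.Properties as ℕ
open import Data.Product using (_×_; _,_; proj₂)
open import Relation.Binary.PropositionalEquality
  using (_≡_; _≢_; refl; sym; trans; cong; cong₂; subst; subst₂; module ≡-Reasoning)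

open CommutativeRing ℤ[i]-commutativeRing using () renaming (*-identityʳ to *ᵍ-identityʳ)

-- The equation rests on a conjugation symmetry. As γ is i times the conjugate of β, γ² is minus the
-- conjugate of β². With c = a + 2bi, the sum of cβ² and the conjugate of c times γ² is therefore 2i
-- times the imaginary part of cβ², namely 4Q(r,s)i. On the other side α² = 4(2x²)i, so the two
-- agree once Q(r,s) = 2x²; `conic-identity` records the difference.
--
-- For the divisibility, let g = gcd(r,s). It divides β coordinatewise. Since Q is homogeneous of
-- degree 2, g² divides Q(r,s) = 2x², hence also 2Q(r,s) = (2x)². The doubling produces a perfect
-- square, so g divides 2x and thus α. Being a common divisor, g divides every gcd of α and β.

-- Cancelling the square of the gcd leaves coprime `m′` and `n′` with `m′` dividing `n′ * n′`;
-- coprimality then removes one factor `n′`. No prime factorisation is involved.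
m*m∣n*n⇒m∣n : ∀ m n → m ℕ.* m ℕ.∣ n ℕ.* n → m ℕ.∣ n
m*m∣n*n⇒m∣n m n mm∣nn = go (gcd-GCD m n)
  where
  go : ∀ {d} → GCD m n d → m ℕ.∣ n
  -- A zero gcd cannot be cancelled, but it forces `n` to be 0.
  go {zero} isGCD =
    subst (m ℕ.∣_) (sym (ℕ.0∣⇒≡0 (proj₂ (GCD.commonDivisor isGCD)))) (m ℕ.∣0)
  go {d@(suc _)} isGCD with GCD.commonDivisor isGCD
  ... | ℕ.divides m′ refl , ℕ.divides n′ refl =
    ℕ.*-monoˡ-∣ d (coprime-divisor {m′} {n′} {n′}
      -- Writing the gcd as `1 * d` lets `GCD-*` cancel `d` from all three arguments.
      (GCD≡1⇒coprime (GCD-* {c = d} (subst (GCD m n) (sym (ℕ.*-identityˡ d)) isGCD)))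
      (ℕ.∣-trans (ℕ.m∣m*n m′) (ℕ.*-cancelʳ-∣ (d ℕ.* d)
        (subst₂ ℕ._∣_ (ℕ.[m*n]*[o*p]≡[m*o]*[n*p] m′ d m′ d)
                      (ℕ.[m*n]*[o*p]≡[m*o]*[n*p] n′ d n′ d) mm∣nn))))

i*i∣j*j⇒i∣j : ∀ i j → i * i ∣ j * j → i ∣ j
i*i∣j*j⇒i∣j i j ii∣jj = ∣ᵤ⇒∣ (m*m∣n*n⇒m∣n ∣ i ∣ ∣ j ∣
  (subst₂ ℕ._∣_ (ℤ.abs-* i i) (ℤ.abs-* j j) (∣⇒∣ᵤ ii∣jj)))

-- g² divides Q(r, s) = 2x², hence (2x)².
common-divisor∣2x : ∀ a b r s x g → eval ⟨ b , a , - b ⟩ r s ≡ + 2 * x ^ 2 →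
                    g ∣ r → g ∣ s → g ∣ + 2 * x
common-divisor∣2x a b r s x g Q≡2x² (divides r′ refl) (divides s′ refl) =
  i*i∣j*j⇒i∣j g (+ 2 * x) (divides (+ 2 * eval ⟨ b , a , - b ⟩ r′ s′) (begin
    (+ 2 * x) * (+ 2 * x)                            ≡⟨ square-double x ⟩
    + 2 * (+ 2 * x ^ 2)                              ≡⟨ cong (+ 2 *_) Q≡2x² ⟨
    + 2 * eval ⟨ b , a , - b ⟩ (r′ * g) (s′ * g)     ≡⟨ homogeneous a b r′ s′ g ⟩
    + 2 * eval ⟨ b , a , - b ⟩ r′ s′ * (g * g)       ∎))
  where
  open ≡-Reasoning
  -- solve-∀ does not handle exponents, so n ^ 2 is unfolded to n * (n * 1ℤ).
  square-double : ∀ x → (+ 2 * x) * (+ 2 * x) ≡ + 2 * (+ 2 * (x * (x * 1ℤ)))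
  square-double = solve-∀
  homogeneous : ∀ a b r s g →
    + 2 * (b * (r * g * (r * g * 1ℤ)) + a * (r * g) * (s * g)
            + - b * (s * g * (s * g * 1ℤ)))
    ≡ + 2 * (b * (r * (r * 1ℤ)) + a * r * s + - b * (s * (s * 1ℤ))) * (g * g)
  homogeneous = solve-∀

fromℤ-∣ᵍ : ∀ {g a b} → g ∣ a → g ∣ b → fromℤ g ∣ᵍ (a +i b)
fromℤ-∣ᵍ {g} (divides p refl) (divides q refl) =
  (p +i q) , cong₂ _+i_ (re-id p q g) (im-id p q g)
  where
  re-id : ∀ p q g → p * g - q * 0ℤ ≡ p * g
  re-id = solve-∀
  im-id : ∀ p q g → p * 0ℤ + q * g ≡ q * g
  im-id = solve-∀

fromℤ-∣ᵍ-* : ∀ {g n} β → g ∣ n → fromℤ g ∣ᵍ fromℤ n *ᵍ β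
fromℤ-∣ᵍ-* {g} (c +i d) (divides q refl) =
  (q * c +i q * d) , cong₂ _+i_ (re-id q g c d) (im-id q g c d)
  where
  re-id : ∀ q g c d → q * c * g - q * d * 0ℤ ≡ q * g * c - 0ℤ * d
  re-id = solve-∀
  im-id : ∀ q g c d → q * c * 0ℤ + q * d * g ≡ q * g * d + 0ℤ * c
  im-id = solve-∀

-- Puts squares in coordinates, so that `conic-identity` splits into two polynomial identities over
-- ℤ.
square : ∀ a b → (a +i b) ^ᵍ 2 ≡ (a * a - b * b) +i (+ 2 * a * b)
square a b = trans (cong ((a +i b) *ᵍ_) (*ᵍ-identityʳ (a +i b)))
                   (cong ((a * a - b * b) +i_) (double a b))
  where
  double : ∀ a b → a * b + b * a ≡ + 2 * a * b
  double = solve-∀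

-- Writing α = 2x(1 + i), β = r + si, γ = s + ri, one has α² = 8x²i, while
-- (a + 2bi)β² + (a − 2bi)γ² = 4Q(r, s)i because β² and γ² have opposite real
-- parts and equal imaginary parts.
conic-identity : ∀ a b r s x →
  (fromℤ (+ 2 * x) *ᵍ (1ℤ +i 1ℤ)) ^ᵍ 2 -ᵍ (a +i + 2 * b) *ᵍ (r +i s) ^ᵍ 2
    -ᵍ (a +i - (+ 2 * b)) *ᵍ (s +i r) ^ᵍ 2
  ≡ 0ℤ +i + 4 * (+ 2 * x ^ 2 - eval ⟨ b , a , - b ⟩ r s)
conic-identity a b r s x = trans
  (cong₂ _-ᵍ_
    (cong₂ (λ α² β² → α² -ᵍ (a +i + 2 * b) *ᵍ β²)
      -- These are the unsimplified coordinates of 2x(1 + i); both equal 2x.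
      (square (+ 2 * x * 1ℤ - 0ℤ * 1ℤ) (+ 2 * x * 1ℤ + 0ℤ * 1ℤ)) (square r s))
    (cong ((a +i - (+ 2 * b)) *ᵍ_) (square s r)))
  (cong₂ _+i_ (re-id a b r s x) (im-id a b r s x))
  where
  re-id : ∀ a b r s x →
    (+ 2 * x * 1ℤ - 0ℤ * 1ℤ) * (+ 2 * x * 1ℤ - 0ℤ * 1ℤ)
      - (+ 2 * x * 1ℤ + 0ℤ * 1ℤ) * (+ 2 * x * 1ℤ + 0ℤ * 1ℤ)
      + - (a * (r * r - s * s) - + 2 * b * (+ 2 * r * s))
      + - (a * (s * s - r * r) - - (+ 2 * b) * (+ 2 * s * r))
    ≡ 0ℤ
  re-id = solve-∀
  im-id : ∀ a b r s x →
    + 2 * (+ 2 * x * 1ℤ - 0ℤ * 1ℤ) * (+ 2 * x * 1ℤ + 0ℤ * 1ℤ)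
      + - (a * (+ 2 * r * s) + + 2 * b * (r * r - s * s))
      + - (a * (+ 2 * s * r) + - (+ 2 * b) * (s * s - r * r))
    ≡ + 4 * (+ 2 * (x * (x * 1ℤ))
              - (b * (r * (r * 1ℤ)) + a * r * s + - b * (s * (s * 1ℤ))))
  im-id = solve-∀

lemma12 : (a b : ℤ) →
    let Q = ⟨ b , a , - b ⟩ in
    discriminant Q ≡ a ^ 2 + + 4 * b ^ 2
    × ((r s x : ℤ) → r ≢ 0ℤ → s ≢ 0ℤ → x ≢ 0ℤ →
       eval Q r s ≡ + 2 * x ^ 2 →
       let α = fromℤ (+ 2 * x) *ᵍ (1ℤ +i 1ℤ)
           β = r +i s
           γ = s +i r
       in
       α ^ᵍ 2 -ᵍ (a +i + 2 * b) *ᵍ β ^ᵍ 2 -ᵍ (a +i - (+ 2 * b)) *ᵍ γ ^ᵍ 2 ≡ 0ᵍ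
       × (∀ δ → IsGCDᵍ α β δ → fromℤ (gcd r s) ∣ᵍ δ))
lemma12 a b = discriminant-id a b , λ r s x _ _ _ Q≡2x² →
    trans (conic-identity a b r s x)
      -- The hypothesis makes the remaining factor 0, and `0ℤ +i + 4 * 0ℤ` computes to `0ᵍ`.
      (cong (λ n → 0ℤ +i + 4 * n) (ℤ.i≡j⇒i-j≡0 (sym Q≡2x²)))
  , λ δ isGCD →
      let g∣r = ∣ᵤ⇒∣ (gcd[i,j]∣i r s)
          g∣s = ∣ᵤ⇒∣ (gcd[i,j]∣j r s)
      in IsGCDᵍ.greatest isGCD
           (fromℤ-∣ᵍ-* (1ℤ +i 1ℤ)
             (common-divisor∣2x a b r s x (gcd r s) Q≡2x² g∣r g∣s))
           (fromℤ-∣ᵍ g∣r g∣s)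
  where
  discriminant-id : ∀ a b → a * (a * 1ℤ) - + 4 * b * - b
                            ≡ a * (a * 1ℤ) + + 4 * (b * (b * 1ℤ))
  discriminant-id = solve-∀
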